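{- The longest overlap-free word over the ternary alphabet $\{0,1,2\}$ whose curling-number transform is $(7/3)$-free has length $84$. That is, there exists an overlap-free ternary word $x$ of length $84$ with $C(x)$ being $(7/3)$-free, and there is no such word of length greater than $84$.
   Context: Words are indexed from $0$: a finite word of length $n$ is $x = x[0]x[1]\cdots x[n-1]$, and $x[i..j]$ denotes the factor (contiguous block) $x[i]\cdots x[j]$. A finite word $x$ of length $n \ge 1$ has period $p$, $1\le p\le n$, if $x[i]=x[i+p]$ for all $0\le i<n-p$; its exponent is $n/p$ where $p$ is its least period. A word is $\alpha$-free if it has no nonempty finite factor of exponent at least $\alpha$. An overlap is a word of the form $a x a x a$ with $a$ a single letter and $x$ a possibly empty word; a word is overlap-free if it contains no overlap as a factor (equivalently, it has no factor of exponent strictly greater than $2$). The curling number of a nonempty finite word $u$ is the largest integer $k \ge 1$ such that $u = y z^k$ for some (possibly empty) word $y$ and some nonempty word $z$. For a finite or infinite word $x$, the curling-number transform $C(x)$ is the word over the positive integers, of the same length as $x$, whose $i$-th letter $C(x)[i]$ is the curling number of the prefix $x[0..i]$. -}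

module Defs where

open import Data.Fin using (Fin; toℕ; fromℕ<)
open import Data.Fin.Properties using (any?; toℕ-fromℕ<)
open import Data.Integer using (+_)
open import Data.List using (List; []; _∷_; _++_; length; lookup; take; drop;
  concat; replicate; filter; upTo; tabulate)
open import Data.List.Extrema.Nat using (max; v≤max⁺; argmax-sel)
open import Data.List.Membership.Propositional.Properties
  using (∈-filter⁺; ∈-filter⁻; ∈-upTo⁺)
open import Data.List.Properties using (≡-dec; length-++; ++-identityʳ)
open import Data.List.Relation.Binary.Infix.Heterogeneous using (Infix)
open import Data.List.Relation.Unary.Any as Any using ()
open import Data.Nat using (ℕ; zero; suc; NonZero; _+_; _≤_; _<_; _≤?_; z≤n; s≤s)
open import Data.Nat.Properties using (≤-refl; ≤-trans; ≤-reflexive; m≤m+n; m≤n+m; +-mono-≤)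
open import Data.Product using (∃; ∃₂; _×_; _,_; proj₂)
open import Data.Rational.Unnormalised as ℚᵘ using (ℚᵘ)
open import Data.Sum using (inj₁; inj₂)
open import Function using (id)
open import Relation.Binary.Definitions using (DecidableEquality)
open import Relation.Binary.PropositionalEquality
  using (_≡_; _≢_; refl; sym; trans; cong; cong₂; subst)
open import Relation.Nullary using (¬_; Dec; no; contradiction)
open import Relation.Nullary.Decidable using (map′; _×-dec_; ¬?)

private
  variable
    A : Set

Factor : List A → List A → Set
Factor = Infix _≡_

OverlapFree : List A → Set
OverlapFree w = ∀ a x → ¬ Factor (a ∷ x ++ a ∷ x ++ a ∷ []) w

record IsPeriod (w : List A) (p : ℕ) : Set where
  field
    positive : 1 ≤ p
    bounded  : p ≤ length w
    repeats  : ∀ (i j : Fin (length w)) → toℕ j ≡ toℕ i + p → lookup w i ≡ lookup w j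

record IsLeastPeriod (w : List A) (p : ℕ) : Set where
  field
    isPeriod : IsPeriod w p
    least    : ∀ {q} → IsPeriod w q → p ≤ q

data HasExponent (w : List A) : ℚᵘ → Set where
  hasExponent : ∀ {p} .{{_ : NonZero p}} → IsLeastPeriod w p →
                HasExponent w (+ length w ℚᵘ./ p)

infix 4 _-Free_

_-Free_ : ℚᵘ → List A → Set
α -Free x = ∀ {w e} → w ≢ [] → Factor w x → HasExponent w e → ¬ (α ℚᵘ.≤ e)

infixr 8 _^_

_^_ : List A → ℕ → List A
z ^ k = concat (replicate k z)

EndsInPower : List A → ℕ → Set
EndsInPower u k = 1 ≤ k × ∃₂ λ y z → z ≢ [] × u ≡ y ++ z ^ k

record IsCurlingNumber (u : List A) (k : ℕ) : Set where
  field
    endsInPower : EndsInPower u k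
    largest     : ∀ {j} → EndsInPower u j → j ≤ k

private
  take-length-++ : ∀ (y t : List A) → take (length y) (y ++ t) ≡ y
  take-length-++ []      t = refl
  take-length-++ (a ∷ y) t = cong (a ∷_) (take-length-++ y t)

  drop-length-++ : ∀ (y t : List A) → drop (length y) (y ++ t) ≡ t
  drop-length-++ []      t = refl
  drop-length-++ (a ∷ y) t = drop-length-++ y t

  length≤-++ : ∀ (y t : List A) → length y ≤ length (y ++ t)
  length≤-++ y t = ≤-trans (m≤m+n _ _) (≤-reflexive (sym (length-++ y)))

  length≤-++ʳ : ∀ (y t : List A) → length t ≤ length (y ++ t)
  length≤-++ʳ y t = ≤-trans (m≤n+m _ (length y)) (≤-reflexive (sym (length-++ y)))

  ≢[]⇒1≤length : ∀ {z : List A} → z ≢ [] → 1 ≤ length z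
  ≢[]⇒1≤length {z = []}    z≢[] = contradiction refl z≢[]
  ≢[]⇒1≤length {z = _ ∷ _} _    = s≤s z≤n

  k≤length-^ : ∀ {z : List A} → z ≢ [] → ∀ k → k ≤ length (z ^ k)
  k≤length-^ z≢[] zero    = z≤n
  k≤length-^ {z = z} z≢[] (suc k) =
    ≤-trans (+-mono-≤ (≢[]⇒1≤length z≢[]) (k≤length-^ z≢[] k))
            (≤-reflexive (sym (length-++ z)))

  endsInPower⇒≤length : ∀ {u : List A} {k} → EndsInPower u k → k ≤ length u
  endsInPower⇒≤length {k = k} (_ , y , z , z≢[] , refl) =
    ≤-trans (k≤length-^ z≢[] k) (length≤-++ʳ y (z ^ k))

module _ (_≟_ : DecidableEquality A) where

  endsInPower? : ∀ (u : List A) k → Dec (EndsInPower u k)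
  endsInPower? u zero    = no λ ()
  endsInPower? u (suc k) = map′ from to (any? λ i → any? λ n → ¬? (≡-dec _≟_ (z i n) []) ×-dec
                                          ≡-dec _≟_ u (y i ++ z i n ^ suc k))
    where
    y : Fin (suc (length u)) → List A
    y i = take (toℕ i) u

    z : Fin (suc (length u)) → Fin (suc (length u)) → List A
    z i n = take (toℕ n) (drop (toℕ i) u)

    from : (∃ λ i → ∃ λ n → z i n ≢ [] × u ≡ y i ++ z i n ^ suc k) → EndsInPower u (suc k)
    from (i , n , z≢[] , eq) = s≤s z≤n , y i , z i n , z≢[] , eq

    to : EndsInPower u (suc k) → ∃ λ i → ∃ λ n → z i n ≢ [] × u ≡ y i ++ z i n ^ suc k
    to (_ , y′ , z′ , z′≢[] , u≡) =
      i , n , (λ eq → z′≢[] (trans (sym zin≡z′) eq)) ,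
      trans u≡ (sym (cong₂ (λ s t → s ++ t ^ suc k) yi≡y′ zin≡z′))
      where
      i< : length y′ < suc (length u)
      i< = s≤s (subst (λ v → length y′ ≤ length v) (sym u≡) (length≤-++ y′ (z′ ^ suc k)))

      n< : length z′ < suc (length u)
      n< = s≤s (subst (λ v → length z′ ≤ length v) (sym u≡)
             (≤-trans (length≤-++ z′ (z′ ^ k)) (length≤-++ʳ y′ (z′ ^ suc k))))

      i = fromℕ< i<
      n = fromℕ< n<

      yi≡y′ : y i ≡ y′
      yi≡y′ = trans (cong₂ take (toℕ-fromℕ< i<) u≡) (take-length-++ y′ (z′ ^ suc k))

      zin≡z′ : z i n ≡ z′
      zin≡z′ = trans (cong₂ take (toℕ-fromℕ< n<)
                       (trans (cong₂ drop (toℕ-fromℕ< i<) u≡) (drop-length-++ y′ (z′ ^ suc k))))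
                     (take-length-++ z′ (z′ ^ k))

  -- The value 1 on the empty word is junk.
  curlingNumber : List A → ℕ
  curlingNumber u = max 1 (filter (endsInPower? u) (upTo (suc (length u))))

  curlingNumber-isCurlingNumber : ∀ {u} → u ≢ [] → IsCurlingNumber u (curlingNumber u)
  curlingNumber-isCurlingNumber {u} u≢[] = record
    { endsInPower = attained
    ; largest     = λ e → v≤max⁺ 1 ks (inj₂ (Any.map ≤-reflexive
        (∈-filter⁺ (endsInPower? u) (∈-upTo⁺ (s≤s (endsInPower⇒≤length e))) e)))
    }
    where
    ks : List ℕ
    ks = filter (endsInPower? u) (upTo (suc (length u)))

    attained : EndsInPower u (max 1 ks)
    attained with argmax-sel id 1 ks
    ... | inj₁ eq  = subst (EndsInPower u) (sym eq)
                       (≤-refl , [] , u , u≢[] , sym (++-identityʳ u))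
    ... | inj₂ ∈ks = proj₂ (∈-filter⁻ (endsInPower? u) {xs = upTo (suc (length u))} ∈ks)

  C : List A → List ℕ
  C x = tabulate {n = length x} λ i → curlingNumber (take (suc (toℕ i)) x)

{-# OPTIONS --safe #-}
module Submission where

open import Defs
open import Data.Bool using (Bool; true; false; not; if_then_else_; _∧_)
open import Data.Bool.Properties using (∧-conicalˡ; ∧-conicalʳ)
open import Data.Fin using (Fin; zero; suc; toℕ; _≟_)
open import Data.Fin.Patterns using (0F; 1F; 2F)
open import Data.Fin.Properties using (all?)
open import Data.Integer as ℤ using (+_)
import Data.Integer.Properties as ℤₚ
open import Data.List using (List; []; _∷_; _++_; _∷ʳ_; [_]; length; lookup; drop; take; map;
  reverse; tabulate; _ʳ++_)
open import Data.List.Properties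
open import Data.List.Relation.Binary.Infix.Heterogeneous as Infix using (MkView; _ⁱ++_)
open import Data.List.Relation.Binary.Pointwise using (Pointwise-≡⇒≡; ≡⇒Pointwise-≡)
open import Data.Nat as ℕ using (ℕ; zero; suc; NonZero; _+_; _*_; _∸_; _≤_; _<_; _≡ᵇ_; z≤n; s≤s;
  s≤s⁻¹; _≤?_; >-nonZero)
open import Data.Nat.DivMod using (_%_; m≡m%n+[m/n]*n; m%n<n; m<n*o⇒m/o<n) renaming (_/_ to _div_)
open import Data.Nat.Induction using (<-rec)
open import Data.Nat.Properties hiding (_≟_)
open import Data.Product using (∃; ∃₂; _×_; _,_; proj₁; proj₂)
open import Data.Rational.Unnormalised as ℚᵘ using (_/_; *≤*)
open import Data.Sum using (inj₁; inj₂)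
open import Function using (_∘_; Injective)
open import Relation.Binary.PropositionalEquality using (_≡_; _≢_; refl; sym; trans; cong; cong₂;
  subst; subst₂; module ≡-Reasoning)
open import Relation.Nullary using (¬_; contradiction; Dec; yes; no; does; Reflects; ofʸ; ofⁿ)
open import Relation.Nullary.Decidable using (map′; _×-dec_; _→-dec_; ¬?; from-yes)
open import Relation.Nullary.Reflects using (fromEquivalence)

-- In an overlap-free word every prefix has curling number 1 or 2, and the value is 2 exactly when
-- the prefix ends in a square. Hence C(x) is a 7/3-free word over {1, 2}. Only polynomially many
-- such words have length 85, and following the tree of those that reach this length while x is
-- extended letter by letter leaves few enough candidates to refute all of them by evaluation. Up
-- to renaming letters x starts with 01 or 001, since 000 is an overlap.

-- The search is evaluated by the type checker, so all that it tests is equality of letters between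
-- a word and a shifted copy of itself. `Valid` mediates between this form and the definitions by
-- factors and least periods; it is reached from them for the bound, and left towards them for the
-- word of length 84. The obstacle to a plain search is that a prefix of `C(x)` can be 7/3-free and
-- yet have no 7/3-free extension of the required length, so that everything below it would be
-- explored in vain. The words that `C(x)` may still become do not depend on `x`, so this look-ahead
-- is computed apart from `x`, on the side of the curling numbers alone. Excluding length 85 is
-- enough, since both conditions on `x` pass to its prefixes.

private
  variable
    A : Set

-- Agreement of two words on their first letters

data Agree {A : Set} : ℕ → List A → List A → Set where
  []  : ∀ {xs ys} → Agree 0 xs ys
  _∷_ : ∀ a {k xs ys} → Agree k xs ys → Agree (suc k) (a ∷ xs) (a ∷ ys)

agree-≤ : ∀ {k l} {xs ys : List A} → k ≤ l → Agree l xs ys → Agree k xs ys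
agree-≤ z≤n       _         = []
agree-≤ (s≤s k≤l) (a ∷ agr) = a ∷ agree-≤ k≤l agr

agree⇒≤length : ∀ {k} {xs ys : List A} → Agree k xs ys → k ≤ length ys
agree⇒≤length []        = z≤n
agree⇒≤length (a ∷ agr) = s≤s (agree⇒≤length agr)

agree-++ : ∀ (w {u v} : List A) → Agree (length w) (w ++ u) (w ++ v)
agree-++ []      = []
agree-++ (a ∷ w) = a ∷ agree-++ w

agree⇒common : ∀ {k} {xs ys : List A} → Agree k xs ys →
               ∃ λ w → ∃₂ λ u v → length w ≡ k × xs ≡ w ++ u × ys ≡ w ++ v
agree⇒common []        = [] , _ , _ , refl , refl , refl
agree⇒common (a ∷ agr) with w , u , v , refl , refl , refl ← agree⇒common agr =
  a ∷ w , u , v , refl , refl , refl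

agree⇒prefix : ∀ (w : List A) {k u ys} → length w ≤ k → Agree k (w ++ u) ys → ∃ λ v → ys ≡ w ++ v
agree⇒prefix []      _         _         = _ , refl
agree⇒prefix (a ∷ w) (s≤s w≤k) (.a ∷ agr) with v , refl ← agree⇒prefix w w≤k agr = v , refl

agree-head : ∀ {k a b} {xs ys : List A} → Agree (suc k) (a ∷ xs) (b ∷ ys) → a ≡ b
agree-head (_ ∷ _) = refl

agree-tail : ∀ {k a b} {xs ys : List A} → Agree (suc k) (a ∷ xs) (b ∷ ys) → Agree k xs ys
agree-tail (_ ∷ agr) = agr

agree-map⁺ : ∀ {f : A → A} {k} {xs ys : List A} → Agree k xs ys → Agree k (map f xs) (map f ys)
agree-map⁺ []        = []
agree-map⁺ {f = f} (a ∷ agr) = f a ∷ agree-map⁺ agr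

agree-map⁻ : ∀ {f : A → A} → Injective _≡_ _≡_ f → ∀ {k} (xs ys : List A) →
             Agree k (map f xs) (map f ys) → Agree k xs ys
agree-map⁻ inj {zero}  _        _        _   = []
agree-map⁻ inj {suc k} (x ∷ xs) (y ∷ ys) agr with refl ← inj (agree-head agr) =
  x ∷ agree-map⁻ inj xs ys (agree-tail agr)

-- Words paired with their curling numbers, and renaming of letters

-- A word that grows at its right end is represented by its reversal r, so that a repetition of
-- period p at the end of the word is an agreement of r with drop p r.
Square Overlap : List A → Set
Square  r = ∃ λ p → Agree (1 + p) r (drop (suc p) r)
Overlap r = ∃ λ p → Agree (2 + p) r (drop (suc p) r)

-- A repetition of period p agrees on 4p/3 letters when its length is 7p/3.
SevenThirds : List A → Set
SevenThirds r = ∃₂ λ p k → 4 * suc p ≤ 3 * k × Agree k r (drop (suc p) r)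

-- `two` does not itself exclude higher powers. In `Valid` it stands beside `¬ Overlap`, and a cube
-- at the end of a word would be an overlap there.
data Curl (r : List A) : ℕ → Set where
  one : ¬ Square r → Curl r 1
  two : Square r → Curl r 2

data Valid {A : Set} : List A → List ℕ → Set where
  []   : Valid [] []
  step : ∀ {a r k c} → Valid r c → ¬ Overlap (a ∷ r) → Curl (a ∷ r) k → ¬ SevenThirds (k ∷ c) →
         Valid (a ∷ r) (k ∷ c)

-- In `w ʳ++ r` the letters of `w` are appended in reading order to the word that `r` reverses.
-- Undoing these appends recovers the conditions under which each letter was added.
valid-suffix : ∀ (w : List A) v {r c} → length w ≡ length v → Valid (w ʳ++ r) (v ʳ++ c) → Valid r c
valid-suffix []      []      _  val = val
valid-suffix (a ∷ w) (k ∷ v) eq val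
  with step val′ _ _ _ ← valid-suffix w v (suc-injective eq) val = val′

valid-length : ∀ {r : List A} {c} → Valid r c → length r ≡ length c
valid-length []               = refl
valid-length (step val _ _ _) = cong suc (valid-length val)

module _ {f : A → A} (inj : Injective _≡_ _≡_ f) where

  private
    drop-map⁻ : ∀ n k r → Agree k (map f r) (drop n (map f r)) → Agree k r (drop n r)
    drop-map⁻ n k r agr = agree-map⁻ inj r (drop n r) (subst (Agree k (map f r)) (drop-map n r) agr)

    drop-map⁺ : ∀ n k r → Agree k r (drop n r) → Agree k (map f r) (drop n (map f r))
    drop-map⁺ n k r agr = subst (Agree k (map f r)) (sym (drop-map n r)) (agree-map⁺ agr)

  curl-map : ∀ {r k} → Curl r k → Curl (map f r) k
  curl-map {r} (one ¬sq)       = one λ (p , agr) → ¬sq (p , drop-map⁻ (suc p) (1 + p) r agr)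
  curl-map {r} (two (p , agr)) = two (p , drop-map⁺ (suc p) (1 + p) r agr)

  -- Repetitions depend only on which letters are equal, and an injective renaming preserves and
  -- reflects that; hence the curling numbers stay the same.
  valid-map : ∀ {r c} → Valid r c → Valid (map f r) c
  valid-map []                     = []
  valid-map (step {a} {r} val ¬ov curl ¬pow) =
    step (valid-map val) (λ (p , agr) → ¬ov (p , drop-map⁻ (suc p) (2 + p) (a ∷ r) agr))
         (curl-map curl) ¬pow

private
  drop-suc : ∀ n (r : List A) {t} → drop n r ≡ t → drop (suc n) r ≡ drop 1 t
  drop-suc zero    r       refl = refl
  drop-suc (suc n) []      refl = refl
  drop-suc (suc n) (_ ∷ r) eq   = drop-suc n r eq

  drop≡[]⇒≤ : ∀ n (r : List A) → drop n r ≡ [] → length r ≤ n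
  drop≡[]⇒≤ zero    []      _  = z≤n
  drop≡[]⇒≤ (suc n) []      _  = z≤n
  drop≡[]⇒≤ (suc n) (_ ∷ r) eq = s≤s (drop≡[]⇒≤ n r eq)

-- Boolean tests for agreement

agree : (A → A → Bool) → ℕ → List A → List A → Bool
agree _≈_ zero    _        _        = true
agree _≈_ (suc k) (x ∷ xs) (y ∷ ys) = (x ≈ y) ∧ agree _≈_ k xs ys
agree _≈_ (suc k) _        _        = false

agree-reflects : ∀ {_≈_ : A → A → Bool} → (∀ a b → Reflects (a ≡ b) (a ≈ b)) →
                 ∀ k xs ys → Reflects (Agree k xs ys) (agree _≈_ k xs ys)
agree-reflects ≈-reflects zero    _        _        = ofʸ []
agree-reflects ≈-reflects (suc k) []       _        = ofⁿ λ ()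
agree-reflects ≈-reflects (suc k) (x ∷ xs) []       = ofⁿ λ ()
agree-reflects {_≈_ = _≈_} ≈-reflects (suc k) (x ∷ xs) (y ∷ ys)
  with x ≈ y | ≈-reflects x y | agree _≈_ k xs ys | agree-reflects ≈-reflects k xs ys
... | true  | ofʸ refl | true  | ofʸ agr  = ofʸ (x ∷ agr)
... | true  | ofʸ refl | false | ofⁿ ¬agr = ofⁿ λ { (_ ∷ agr) → ¬agr agr }
... | false | ofⁿ x≢y  | _     | _        = ofⁿ (x≢y ∘ agree-head)

-- A plain table with Boolean values, so that the search computes without building proofs;
-- `≈-reflects` supplies them afterwards.
_≈_ : Fin 3 → Fin 3 → Bool
0F ≈ 0F = true
1F ≈ 1F = true
2F ≈ 2F = true
_  ≈ _  = false

≈-reflects : ∀ a b → Reflects (a ≡ b) (a ≈ b)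
≈-reflects 0F 0F = ofʸ refl
≈-reflects 0F 1F = ofⁿ λ ()
≈-reflects 0F 2F = ofⁿ λ ()
≈-reflects 1F 0F = ofⁿ λ ()
≈-reflects 1F 1F = ofʸ refl
≈-reflects 1F 2F = ofⁿ λ ()
≈-reflects 2F 0F = ofⁿ λ ()
≈-reflects 2F 1F = ofⁿ λ ()
≈-reflects 2F 2F = ofʸ refl

≡ᵇ-reflects : ∀ m n → Reflects (m ≡ n) (m ≡ᵇ n)
≡ᵇ-reflects m n = fromEquivalence (≡ᵇ⇒≡ m n) (≡⇒≡ᵇ m n)

-- The search

data Verdict : Set where
  overlapping squared squareFree : Verdict

-- A square of one period leaves the verdict open: a longer period may still give an overlap.
addSquare : Verdict → Verdict
addSquare overlapping = overlapping
addSquare _           = squared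

-- A pair (e , o) records that appending e completes a square, and even an overlap when o is
-- true. Every call has ts = drop j r and hs = drop (j + j) r, so that the scan stops as soon as
-- the period exceeds half of the length.
completions : ℕ → List (Fin 3) → List (Fin 3) → List (Fin 3) → List (Fin 3 × Bool)
completions j r (e ∷ ts) (_ ∷ hs) =
  if agree _≈_ j r ts
  then (e , agree _≈_ (suc j) r ts) ∷ completions (suc j) r ts (drop 1 hs)
  else completions (suc j) r ts (drop 1 hs)
completions _ _ _        _        = []

-- For each period the new letter matters only through its equality with the letter one period back.
-- One list of completions of `r` therefore serves all three letters.
verdict : Fin 3 → List (Fin 3 × Bool) → Verdict
verdict a []            = squareFree
verdict a ((e , o) ∷ l) =
  if a ≈ e then (if o then overlapping else addSquare (verdict a l)) else verdict a l

-- Here `p` is the period minus one, as `drop (suc p) (a ∷ r)` is `drop p r`. Only the negative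
-- claims are limited to `j ≤ p`; a scan from `j` onwards knows nothing of shorter periods, and at
-- `j = 0` the limit disappears.
data Correct (j : ℕ) (a : Fin 3) (r : List (Fin 3)) : Verdict → Set where
  overlapping : ∀ {p} → Agree (2 + p) (a ∷ r) (drop p r) → Correct j a r overlapping
  squared     : (∀ {p} → j ≤ p → ¬ Agree (2 + p) (a ∷ r) (drop p r)) →
                ∀ {p} → Agree (1 + p) (a ∷ r) (drop p r) → Correct j a r squared
  squareFree  : (∀ {p} → j ≤ p → ¬ Agree (1 + p) (a ∷ r) (drop p r)) → Correct j a r squareFree

private
  from-suc : ∀ {j} {P : ℕ → Set} → ¬ P j → (∀ {p} → suc j ≤ p → ¬ P p) → ∀ {p} → j ≤ p → ¬ P p
  from-suc ¬Pj ¬P> j≤p with m≤n⇒m<n∨m≡n j≤p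
  ... | inj₁ j<p  = ¬P> j<p
  ... | inj₂ refl = ¬Pj

  skip : ∀ {j a r} → ¬ Agree (1 + j) (a ∷ r) (drop j r) →
         ∀ {s} → Correct (suc j) a r s → Correct j a r s
  skip ¬agr (overlapping agr) = overlapping agr
  skip ¬agr (squared ¬ov agr) = squared (from-suc (¬agr ∘ agree-≤ (n≤1+n _)) ¬ov) agr
  skip ¬agr (squareFree ¬sq)  = squareFree (from-suc ¬agr ¬sq)

  add : ∀ {j a r} → ¬ Agree (2 + j) (a ∷ r) (drop j r) → Agree (1 + j) (a ∷ r) (drop j r) →
        ∀ {s} → Correct (suc j) a r s → Correct j a r (addSquare s)
  add ¬ov agr (overlapping agr′) = overlapping agr′
  add ¬ov agr (squared ¬ov′ _)   = squared (from-suc ¬ov ¬ov′) agr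
  add ¬ov agr (squareFree ¬sq)   = squared (from-suc ¬ov λ j<p → ¬sq j<p ∘ agree-≤ (n≤1+n _)) agr

  -- A square of period `1 + p` at the end of `a ∷ r` takes `2 + 2p` letters, so `r` would have at
  -- least `1 + 2p`, which exceeds `j + j`.
  tooLong : ∀ {j} a (r : List (Fin 3)) → length r ≤ j + j →
            ∀ {p} → j ≤ p → ¬ Agree (1 + p) (a ∷ r) (drop p r)
  tooLong {j} a r r≤2j {p} j≤p agr =
    contradiction 1+p≤ (<⇒≱ (s≤s (≤-trans r∸p≤ (≤-reflexive (m+n∸n≡m p p)))))
    where
    1+p≤ : 1 + p ≤ length r ∸ p
    1+p≤ = ≤-trans (agree⇒≤length agr) (≤-reflexive (length-drop p r))

    r∸p≤ : length r ∸ p ≤ (p + p) ∸ p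
    r∸p≤ = ∸-monoˡ-≤ p (≤-trans r≤2j (+-mono-≤ j≤p j≤p))

verdict-correct : ∀ j a r ts hs → drop j r ≡ ts → drop (j + j) r ≡ hs →
                  Correct j a r (verdict a (completions j r ts hs))
verdict-correct j a r []       hs ts≡ _   =
  squareFree (tooLong a r (≤-trans (drop≡[]⇒≤ j r ts≡) (m≤m+n j j)))
verdict-correct j a r (e ∷ ts) [] _   hs≡ = squareFree (tooLong a r (drop≡[]⇒≤ (j + j) r hs≡))
verdict-correct j a r (e ∷ ts) (h ∷ hs) ts≡ hs≡
  with agree _≈_ j r ts | agree-reflects ≈-reflects j r ts
     | verdict-correct (suc j) a r ts (drop 1 hs) (drop-suc j r ts≡)
         (trans (cong (λ n → drop (suc n) r) (+-suc j j))
                (drop-suc (suc (j + j)) r (drop-suc (j + j) r hs≡)))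
... | false | ofⁿ ¬agr | ih = skip (¬agr ∘ agree-tail ∘ subst (Agree (suc j) (a ∷ r)) ts≡) ih
... | true  | ofʸ agr  | ih with a ≈ e | ≈-reflects a e
...   | false | ofⁿ a≢e  = skip (a≢e ∘ agree-head ∘ subst (Agree (suc j) (a ∷ r)) ts≡) ih
...   | true  | ofʸ refl with agree _≈_ (suc j) r ts | agree-reflects ≈-reflects (suc j) r ts
...     | true  | ofʸ agr⁺  =
  overlapping {p = j} (subst (Agree (2 + j) (a ∷ r)) (sym ts≡) (a ∷ agr⁺))
...     | false | ofⁿ ¬agr⁺ =
  add (¬agr⁺ ∘ agree-tail ∘ subst (Agree (2 + j) (a ∷ r)) ts≡)
      (subst (Agree (1 + j) (a ∷ r)) (sym ts≡) (a ∷ agr)) ih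

-- Recognising exponent 7/3 at the end of the curling word

sevenThirds : ℕ → List ℕ → List ℕ → Bool
sevenThirds p c []       = false
sevenThirds p c (k ∷ ts) =
  -- The count is `4 * suc p / 3` rounded up, the least agreement that `SevenThirds` accepts for the
  -- period `suc p`.
  if agree _≡ᵇ_ ((4 * suc p + 2) div 3) c (k ∷ ts) then true else sevenThirds (suc p) c ts

endsInSevenThirds : List ℕ → Bool
endsInSevenThirds []      = false
endsInSevenThirds (k ∷ c) = sevenThirds 0 (k ∷ c) c

private
  ⌈4m/3⌉-least : ∀ {m k} → 4 * m ≤ 3 * k → (4 * m + 2) div 3 ≤ k
  ⌈4m/3⌉-least {m} {k} 4m≤3k = s≤s⁻¹ (m<n*o⇒m/o<n {4 * m + 2} {suc k} {3} (begin-strict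
    4 * m + 2 <⟨ +-monoʳ-< (4 * m) ≤-refl ⟩
    4 * m + 3 ≤⟨ +-monoˡ-≤ 3 4m≤3k ⟩
    3 * k + 3 ≡⟨ +-comm (3 * k) 3 ⟩
    3 + 3 * k ≡⟨ cong (λ x → 3 + x) (*-comm 3 k) ⟩
    suc k * 3 ∎))
    where open ≤-Reasoning

  4m≤3⌈4m/3⌉ : ∀ m → 4 * m ≤ 3 * ((4 * m + 2) div 3)
  4m≤3⌈4m/3⌉ m = +-cancelˡ-≤ 2 _ _ (begin
    2 + 4 * m           ≡⟨ +-comm 2 (4 * m) ⟩
    n                   ≡⟨ m≡m%n+[m/n]*n n 3 ⟩
    n % 3 + n div 3 * 3 ≤⟨ +-monoˡ-≤ (n div 3 * 3) (s≤s⁻¹ (m%n<n n 3)) ⟩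
    2 + n div 3 * 3     ≡⟨ cong (λ x → 2 + x) (*-comm (n div 3) 3) ⟩
    2 + 3 * (n div 3)   ∎)
    where
    open ≤-Reasoning
    n = 4 * m + 2

  sevenThirds-sound : ∀ p c ts → drop (suc p) c ≡ ts → sevenThirds p c ts ≡ true → SevenThirds c
  sevenThirds-sound p c (k ∷ ts) ts≡ eq
    with agree _≡ᵇ_ ((4 * suc p + 2) div 3) c (k ∷ ts)
       | agree-reflects ≡ᵇ-reflects ((4 * suc p + 2) div 3) c (k ∷ ts)
  ... | true  | ofʸ agr = p , _ , 4m≤3⌈4m/3⌉ (suc p) , subst (Agree _ c) (sym ts≡) agr
  ... | false | _       = sevenThirds-sound (suc p) c ts (drop-suc (suc p) c ts≡) eq

  sevenThirds-complete : ∀ p c ts → drop (suc p) c ≡ ts → sevenThirds p c ts ≡ false →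
                         ∀ {q k} → p ≤ q → 4 * suc q ≤ 3 * k → ¬ Agree k c (drop (suc q) c)
  sevenThirds-complete p c [] ts≡ _ {q} {zero}  p≤q () _
  sevenThirds-complete p c [] ts≡ _ {q} {suc k} p≤q _ agr =
    contradiction (≤-trans (agree⇒≤length agr) (≤-reflexive (trans (length-drop (suc q) c)
      (m≤n⇒m∸n≡0 (≤-trans (drop≡[]⇒≤ (suc p) c ts≡) (s≤s p≤q)))))) λ ()
  sevenThirds-complete p c (k ∷ ts) ts≡ eq p≤q 4q≤3l agr′
    with agree _≡ᵇ_ ((4 * suc p + 2) div 3) c (k ∷ ts)
       | agree-reflects ≡ᵇ-reflects ((4 * suc p + 2) div 3) c (k ∷ ts) | m≤n⇒m<n∨m≡n p≤q
  ... | false | ofⁿ ¬agr | inj₂ refl =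
    ¬agr (agree-≤ (⌈4m/3⌉-least {suc p} 4q≤3l) (subst (Agree _ c) ts≡ agr′))
  ... | false | ofⁿ ¬agr | inj₁ p<q  =
    sevenThirds-complete (suc p) c ts (drop-suc (suc p) c ts≡) eq p<q 4q≤3l agr′

endsInSevenThirds-sound : ∀ c → endsInSevenThirds c ≡ true → SevenThirds c
endsInSevenThirds-sound (k ∷ c) eq = sevenThirds-sound 0 (k ∷ c) c refl eq

endsInSevenThirds-complete : ∀ c → endsInSevenThirds c ≡ false → ¬ SevenThirds c
endsInSevenThirds-complete []      _  (_ , zero , () , _)
endsInSevenThirds-complete []      _  (_ , suc _ , _ , ())
endsInSevenThirds-complete (k ∷ c) eq (_ , _ , 4p≤3k , agr) =
  sevenThirds-complete 0 (k ∷ c) c refl eq z≤n 4p≤3k agr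

-- The tree of possible curling words

-- A tree whose branches are the words over {1, 2} of a fixed length that extend a given 7/3-free
-- word: dead has no branch, and pruning dead subtrees is what keeps the search below feasible.
data Tree : Set where
  dead leaf : Tree
  live      : Tree → Tree → Tree

data Branch : List ℕ → Tree → Set where
  []  : Branch [] leaf
  1∷_ : ∀ {v t u} → Branch v t → Branch (1 ∷ v) (live t u)
  2∷_ : ∀ {v t u} → Branch v u → Branch (2 ∷ v) (live t u)

prune : Tree → Tree → Tree
prune dead dead = dead
prune t    u    = live t u

extensions : ℕ → List ℕ → Tree
extensions zero    c = leaf
extensions (suc n) c = prune (if endsInSevenThirds (1 ∷ c) then dead else extensions n (1 ∷ c))
                             (if endsInSevenThirds (2 ∷ c) then dead else extensions n (2 ∷ c))

branch-prune₁ : ∀ {v t u} → Branch v t → Branch (1 ∷ v) (prune t u)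
branch-prune₁ {t = leaf}     b = 1∷ b
branch-prune₁ {t = live _ _} b = 1∷ b

branch-prune₂ : ∀ {v t u} → Branch v u → Branch (2 ∷ v) (prune t u)
branch-prune₂ {t = dead}     {leaf}     b = 2∷ b
branch-prune₂ {t = dead}     {live _ _} b = 2∷ b
branch-prune₂ {t = leaf}     b = 2∷ b
branch-prune₂ {t = live _ _} b = 2∷ b

branch-if : ∀ {v c t} → ¬ SevenThirds c → Branch v t → Branch v (if endsInSevenThirds c then dead else t)
branch-if {c = c} ¬pow b with endsInSevenThirds c in eq
... | false = b
... | true  = contradiction (endsInSevenThirds-sound c eq) ¬pow

-- The step that added `k` shows by its `Curl` that `k` is 1 or 2, and by its last condition that
-- this child was not cut. The rest of `v` is a branch of the child, so `prune` keeps it.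
valid⇒branch : ∀ (w : List A) v {r c} → length w ≡ length v → Valid (w ʳ++ r) (v ʳ++ c) →
               Branch v (extensions (length v) c)
valid⇒branch []      []      _  _   = []
valid⇒branch (a ∷ w) (k ∷ v) eq val
  with step _ _ curl ¬pow ← valid-suffix w v (suc-injective eq) val | curl
... | one _ = branch-prune₁ (branch-if ¬pow (valid⇒branch w v (suc-injective eq) val))
... | two _ = branch-prune₂ (branch-if ¬pow (valid⇒branch w v (suc-injective eq) val))

-- Refutation by extending the word along the tree

refute : Tree → List (Fin 3) → Bool
refuteLetters : Tree → Tree → List (Fin 3) → List (Fin 3 × Bool) → Bool
-- The verdict on the appended letter forces the next curling number, so each letter enters at most
-- one of the two subtrees.
refuteLetter : Tree → Tree → List (Fin 3) → Fin 3 → Verdict → Bool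

refute dead       r = true
refute leaf       r = false
refute (live t u) r = refuteLetters t u r (completions 0 r r r)

refuteLetters t u r l = refuteLetter t u r 0F (verdict 0F l) ∧
                        (refuteLetter t u r 1F (verdict 1F l) ∧ refuteLetter t u r 2F (verdict 2F l))

refuteLetter t u r a overlapping = true
refuteLetter t u r a squared     = refute u (a ∷ r)
refuteLetter t u r a squareFree  = refute t (a ∷ r)

refuteLetters⇒refuteLetter : ∀ t u r l → refuteLetters t u r l ≡ true →
                             ∀ a → refuteLetter t u r a (verdict a l) ≡ true
refuteLetters⇒refuteLetter t u r l eq 0F = ∧-conicalˡ _ _ eq
refuteLetters⇒refuteLetter t u r l eq 1F =
  ∧-conicalˡ _ _ (∧-conicalʳ (refuteLetter t u r 0F (verdict 0F l)) _ eq)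
refuteLetters⇒refuteLetter t u r l eq 2F =
  ∧-conicalʳ (refuteLetter t u r 1F (verdict 1F l)) _
    (∧-conicalʳ (refuteLetter t u r 0F (verdict 0F l)) _ eq)

-- Word and branch are followed together. At each letter the verdict either agrees with the branch,
-- and the refutation continues in that subtree, or contradicts a condition of `Valid`. The branch
-- cannot end at a leaf, where `refute` is `false`.
refute-sound : ∀ {v t} → Branch v t → ∀ w {r c} → refute t r ≡ true → length w ≡ length v →
               ¬ Valid (w ʳ++ r) (v ʳ++ c)
refute-sound (1∷ b) [] _ ()
refute-sound (2∷ b) [] _ ()
refute-sound {t = live t u} b (a ∷ w) {r} {c} eq len val
  with verdict a (completions 0 r r r) | verdict-correct 0 a r r r refl refl
     | refuteLetters⇒refuteLetter t u r (completions 0 r r r) eq a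
refute-sound {1 ∷ v} (1∷ b) (a ∷ w) {r} {c} eq len val | _ | correct | eq′
  with correct | valid-suffix w v {a ∷ r} {1 ∷ c} (suc-injective len) val
... | overlapping agr | step _ ¬ov _ _             = ¬ov (_ , agr)
... | squared _ agr   | step _ _ (one ¬sq) _       = ¬sq (_ , agr)
... | squareFree _    | step _ _ _ _               = refute-sound b w eq′ (suc-injective len) val
refute-sound {2 ∷ v} (2∷ b) (a ∷ w) {r} {c} eq len val | _ | correct | eq′
  with correct | valid-suffix w v {a ∷ r} {2 ∷ c} (suc-injective len) val
... | overlapping agr | step _ ¬ov _ _             = ¬ov (_ , agr)
... | squared _ _     | step _ _ _ _               = refute-sound b w eq′ (suc-injective len) val
... | squareFree ¬sq  | step _ _ (two (_ , agr)) _ = ¬sq z≤n agr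

-- Checking a given word with its curling numbers

allows : Verdict → ℕ → Bool
allows squareFree 1 = true
allows squared    2 = true
allows _          _ = false

validᵇ : List (Fin 3) → List ℕ → Bool
validᵇ []      []      = true
validᵇ (a ∷ r) (k ∷ c) = allows (verdict a (completions 0 r r r)) k ∧
                         (not (endsInSevenThirds (k ∷ c)) ∧ validᵇ r c)
validᵇ _       _       = false

validᵇ-sound : ∀ r c → validᵇ r c ≡ true → Valid r c
validᵇ-sound []      []      _  = []
validᵇ-sound (a ∷ r) (k ∷ c) eq
  with verdict a (completions 0 r r r) | verdict-correct 0 a r r r refl refl
validᵇ-sound (a ∷ r) (1 ∷ c) eq | _ | squareFree ¬sq with endsInSevenThirds (1 ∷ c) in eq′
... | false = step (validᵇ-sound r c eq) (λ (_ , agr) → ¬sq z≤n (agree-≤ (n≤1+n _) agr))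
                   (one λ (_ , agr) → ¬sq z≤n agr) (endsInSevenThirds-complete (1 ∷ c) eq′)
validᵇ-sound (a ∷ r) (2 ∷ c) eq | _ | squared ¬ov agr with endsInSevenThirds (2 ∷ c) in eq′
... | false = step (validᵇ-sound r c eq) (λ (_ , agr) → ¬ov z≤n agr)
                   (two (_ , agr)) (endsInSevenThirds-complete (2 ∷ c) eq′)

-- Factors and reversal

factor⁺ : ∀ (u w v : List A) → Factor w (u ++ w ++ v)
factor⁺ u w v = Infix.fromView (MkView u (≡⇒Pointwise-≡ refl) v)

factor⁻ : ∀ {w x : List A} → Factor w x → ∃₂ λ u v → x ≡ u ++ w ++ v
factor⁻ f with MkView u w≡ v ← Infix.toView f with refl ← Pointwise-≡⇒≡ w≡ = u , v , refl

reverse-++₃ : ∀ (u w v : List A) → reverse (u ++ w ++ v) ≡ reverse v ++ reverse w ++ reverse u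
reverse-++₃ u w v = trans (reverse-++ u (w ++ v)) (trans (cong (_++ reverse u) (reverse-++ w v))
                      (++-assoc (reverse v) (reverse w) (reverse u)))

reverse-swap : ∀ {x y : List A} → reverse x ≡ y → x ≡ reverse y
reverse-swap {x = x} refl = sym (reverse-involutive x)

factor-reverse : ∀ (u w v : List A) → Factor (reverse w) (reverse (u ++ w ++ v))
factor-reverse u w v =
  subst (Factor _) (sym (reverse-++₃ u w v)) (factor⁺ (reverse v) (reverse w) (reverse u))

factor-reverse⁻ : ∀ {w r : List A} → Factor w (reverse r) → ∃₂ λ u v → r ≡ u ++ reverse w ++ v
factor-reverse⁻ {w = w} f with u , v , eq ← factor⁻ f =
  reverse v , reverse u , trans (reverse-swap eq) (reverse-++₃ u w v)

factor-snoc : ∀ {w : List A} a r → Factor w (reverse r) → Factor w (reverse (a ∷ r))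
factor-snoc a r f = subst (Factor _) (sym (unfold-reverse a r)) (f ⁱ++ [ a ])

drop-length-++ : ∀ (y t : List A) → drop (length y) (y ++ t) ≡ t
drop-length-++ []      t = refl
drop-length-++ (_ ∷ y) t = drop-length-++ y t

split-at : ∀ p (r : List A) → p ≤ length r → ∃ λ w → length w ≡ p × r ≡ w ++ drop p r
split-at p r p≤r = take p r , trans (length-take p r) (m≤n⇒m⊓n≡m p≤r) , sym (take++drop≡id p r)

agree⇒≤lengthˡ : ∀ {k} {xs ys : List A} → Agree k xs ys → k ≤ length xs
agree⇒≤lengthˡ []        = z≤n
agree⇒≤lengthˡ (a ∷ agr) = s≤s (agree⇒≤lengthˡ agr)

repetition⇒prefix : ∀ {p k} {r : List A} → p ≤ k → Agree k r (drop p r) →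
                    ∃₂ λ w v → length w ≡ p × r ≡ w ++ w ++ v
repetition⇒prefix {p = p} {k} {r} p≤k agr
  with w , refl , r≡ ← split-at p r (≤-trans p≤k (agree⇒≤lengthˡ agr))
  with v , eq ← agree⇒prefix w p≤k (subst (λ s → Agree k s (drop p r)) r≡ agr) =
  w , v , refl , trans r≡ (cong (w ++_) eq)

-- Overlaps

length-∷ʳ : ∀ (y : List A) a → length (y ∷ʳ a) ≡ suc (length y)
length-∷ʳ y a = trans (length-++ y) (+-comm (length y) 1)

overlap⇒prefix : ∀ {r : List A} → Overlap r → ∃ λ a → ∃₂ λ y v → r ≡ (a ∷ y ++ a ∷ y ++ a ∷ []) ++ v
overlap⇒prefix {r = r} (p , agr)
  with a ∷ y , v , refl , refl ← repetition⇒prefix {p = suc p} (n≤1+n _) agr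
  -- The agreement runs one letter beyond the block `a ∷ y`, so the second copy of the block is
  -- followed by its own first letter.
  with v′ , eq ← agree⇒prefix (a ∷ y ∷ʳ a) (≤-reflexive (cong suc (length-∷ʳ y a)))
         (subst₂ (Agree (2 + length y)) (cong (a ∷_) (sym (++-assoc y (a ∷ []) (y ++ v))))
            (drop-length-++ (a ∷ y) (a ∷ y ++ v)) agr) =
  a , y , v′ , trans (cong ((a ∷ y) ++_) eq) (sym (++-assoc (a ∷ y) (a ∷ y ∷ʳ a) v′))

reverse-overlap : ∀ a (y : List A) →
                  reverse (a ∷ y ++ a ∷ y ++ a ∷ []) ≡ a ∷ reverse y ++ a ∷ reverse y ++ a ∷ []
reverse-overlap a y = begin
  reverse ((a ∷ y) ++ (a ∷ y) ++ a ∷ [])   ≡⟨ reverse-++₃ (a ∷ y) (a ∷ y) (a ∷ []) ⟩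
  a ∷ reverse (a ∷ y) ++ reverse (a ∷ y)   ≡⟨ cong (λ z → a ∷ z ++ z) (unfold-reverse a y) ⟩
  a ∷ (reverse y ∷ʳ a) ++ (reverse y ∷ʳ a) ≡⟨ cong (a ∷_) (++-assoc (reverse y) (a ∷ []) (reverse y ∷ʳ a)) ⟩
  a ∷ reverse y ++ a ∷ reverse y ++ a ∷ [] ∎
  where open ≡-Reasoning

overlapFree⇒¬overlap : ∀ {r : List A} → OverlapFree (reverse r) → ¬ Overlap r
overlapFree⇒¬overlap free ov with a , y , v , refl ← overlap⇒prefix ov =
  free a (reverse y)
    (subst (λ z → Factor z (reverse ((a ∷ y ++ a ∷ y ++ a ∷ []) ++ v))) (reverse-overlap a y)
      (factor-reverse [] (a ∷ y ++ a ∷ y ++ a ∷ []) v))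

prefix⇒overlap : ∀ a (y v : List A) → Overlap ((a ∷ y ++ a ∷ y ++ a ∷ []) ++ v)
prefix⇒overlap a y v = length y ,
  subst₂ (λ k s → Agree k s (drop (suc (length y)) s)) (cong suc (length-∷ʳ y a)) (sym r≡)
    (subst (Agree (length (a ∷ y ∷ʳ a)) (a ∷ y ++ a ∷ y ++ a ∷ v))
      (trans (++-assoc (a ∷ y) (a ∷ []) v) (sym (drop-length-++ (a ∷ y) (a ∷ y ++ a ∷ v))))
      (subst (λ s → Agree (length (a ∷ y ∷ʳ a)) s ((a ∷ y ∷ʳ a) ++ v))
        (++-assoc (a ∷ y) (a ∷ []) (y ++ a ∷ v))
        (agree-++ (a ∷ y ∷ʳ a))))
  where
  r≡ : (a ∷ y ++ a ∷ y ++ a ∷ []) ++ v ≡ a ∷ y ++ a ∷ y ++ a ∷ v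
  r≡ = trans (++-assoc (a ∷ y) (a ∷ y ++ a ∷ []) v) (cong (λ z → a ∷ y ++ a ∷ z) (++-assoc y (a ∷ []) v))

-- Squares and curling numbers

^-+ : ∀ (z : List A) m n → z ^ (m + n) ≡ z ^ m ++ z ^ n
^-+ z zero    n = refl
^-+ z (suc m) n = trans (cong (z ++_) (^-+ z m n)) (sym (++-assoc z (z ^ m) (z ^ n)))

square⇒endsInPower : ∀ {r : List A} → Square r → EndsInPower (reverse r) 2
square⇒endsInPower {r = r} (p , agr)
  with w@(_ ∷ _) , v , refl , refl ← repetition⇒prefix {p = suc p} ≤-refl agr =
  s≤s z≤n , reverse v , reverse w , (λ eq → contradiction (reverse-injective {x = w} {y = []} eq) λ ()) ,
  trans (reverse-++₃ w w v) (cong (λ z → reverse v ++ reverse w ++ z) (sym (++-identityʳ (reverse w))))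

endsInPower⇒square : ∀ {r : List A} {m} → EndsInPower (reverse r) (2 + m) → Square r
endsInPower⇒square {r = r} {m} (_ , y , z , z≢[] , eq) = conclude (reverse z) refl
  where
  open ≡-Reasoning
  r≡ : r ≡ reverse z ++ reverse z ++ reverse (y ++ z ^ m)
  r≡ = reverse-injective (begin
    reverse r                                              ≡⟨ eq ⟩
    y ++ z ^ (2 + m)                                       ≡⟨ cong (λ n → y ++ z ^ n) (+-comm 2 m) ⟩
    -- The last two copies of `z` are split off; under reversal they become the first two blocks of
    -- `r`.
    y ++ z ^ (m + 2)                                       ≡⟨ cong (y ++_) (^-+ z m 2) ⟩
    y ++ z ^ m ++ z ++ z ++ []                             ≡⟨ cong (λ s → y ++ z ^ m ++ z ++ s)
                                                                (++-identityʳ z) ⟩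
    y ++ z ^ m ++ z ++ z                                   ≡⟨ ++-assoc y (z ^ m) (z ++ z) ⟨
    (y ++ z ^ m) ++ z ++ z                                 ≡⟨ reverse-involutive _ ⟨
    reverse (reverse ((y ++ z ^ m) ++ z ++ z))             ≡⟨ cong reverse (reverse-++₃ (y ++ z ^ m) z z) ⟩
    reverse (reverse z ++ reverse z ++ reverse (y ++ z ^ m)) ∎)

  conclude : ∀ w → w ≡ reverse z → Square r
  conclude []      w≡ = contradiction (reverse-injective {x = z} {y = []} (sym w≡)) z≢[]
  conclude (a ∷ w) w≡ rewrite r≡ | sym w≡ =
    length w , subst (Agree _ _) (sym (drop-length-++ (a ∷ w) _)) (agree-++ (a ∷ w))

-- The cube of `a ∷ z` begins with the overlap `a z a z a`.
endsInPower⇒¬overlapFree : ∀ {x : List A} {m} → EndsInPower x (3 + m) → ¬ OverlapFree x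
endsInPower⇒¬overlapFree (_ , y , []    , z≢[] , _)    _    = z≢[] refl
endsInPower⇒¬overlapFree {m = m} (_ , y , a ∷ z , _ , refl) free =
  free a z (subst (Factor _) eq (factor⁺ y (a ∷ z ++ a ∷ z ++ a ∷ []) (z ++ (a ∷ z) ^ m)))
  where
  eq : y ++ (a ∷ z ++ a ∷ z ++ a ∷ []) ++ z ++ (a ∷ z) ^ m ≡ y ++ (a ∷ z) ^ (3 + m)
  eq = cong (y ++_) (trans (++-assoc (a ∷ z) (a ∷ z ++ a ∷ []) (z ++ (a ∷ z) ^ m))
         (cong (λ s → a ∷ z ++ a ∷ s) (++-assoc z (a ∷ []) (z ++ (a ∷ z) ^ m))))

curl-unique : ∀ {r : List A} {k l} → Curl r k → Curl r l → k ≡ l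
curl-unique (one _)   (one _)   = refl
curl-unique (one ¬sq) (two sq)  = contradiction sq ¬sq
curl-unique (two sq)  (one ¬sq) = contradiction sq ¬sq
curl-unique (two _)   (two _)   = refl

isCurlingNumber⇒curl : ∀ {r : List A} {k} → OverlapFree (reverse r) →
                       IsCurlingNumber (reverse r) k → Curl r k
isCurlingNumber⇒curl {k = zero} _ cn = contradiction (proj₁ (IsCurlingNumber.endsInPower cn)) λ ()
isCurlingNumber⇒curl {k = 1} _ cn =
  one λ sq → contradiction (IsCurlingNumber.largest cn (square⇒endsInPower sq)) λ { (s≤s ()) }
isCurlingNumber⇒curl {k = 2} _ cn = two (endsInPower⇒square (IsCurlingNumber.endsInPower cn))
isCurlingNumber⇒curl {k = suc (suc (suc _))} free cn =
  contradiction free (endsInPower⇒¬overlapFree (IsCurlingNumber.endsInPower cn))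

curlings : List (Fin 3) → List ℕ
curlings []      = []
curlings (a ∷ r) = curlingNumber _≟_ (reverse (a ∷ r)) ∷ curlings r

reverse-C : ∀ x → reverse (C _≟_ x) ≡ curlings (reverse x)
reverse-C x = go x []
  where
  -- `C` looks at prefixes of the whole word, so the induction over the unread part `w` has to carry
  -- along the part already read, reversed in `r`.
  go : ∀ w r →
       tabulate {n = length w} (λ i → curlingNumber _≟_ (reverse r ++ take (suc (toℕ i)) w)) ʳ++ curlings r
         ≡ curlings (w ʳ++ r)
  go []      r = refl
  go (a ∷ w) r = trans
    (cong₂ (λ k l → l ʳ++ (k ∷ curlings r))
      (cong (curlingNumber _≟_) (sym (unfold-reverse a r)))
      (tabulate-cong {n = length w} λ i → cong (curlingNumber _≟_)
        (trans (sym (++-assoc (reverse r) [ a ] (take (suc (toℕ i)) w)))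
               (cong (_++ take (suc (toℕ i)) w) (sym (unfold-reverse a r))))))
    (go w (a ∷ r))

curlings-curl : ∀ a (r : List (Fin 3)) → OverlapFree (reverse (a ∷ r)) →
                Curl (a ∷ r) (curlingNumber _≟_ (reverse (a ∷ r)))
curlings-curl a r free = isCurlingNumber⇒curl free (curlingNumber-isCurlingNumber _≟_
  λ eq → contradiction (reverse-injective {x = a ∷ r} {y = []} eq) λ ())

-- Periods

-- The index type of `lookup` depends on the length of the word. With a natural number as position,
-- statements can be moved along equations between words.
data At {A : Set} : List A → ℕ → A → Set where
  here  : ∀ {a w} → At (a ∷ w) 0 a
  there : ∀ {a b w n} → At w n b → At (a ∷ w) (suc n) b

at-lookup : ∀ (w : List A) i → At w (toℕ i) (lookup w i)
at-lookup (a ∷ w) zero    = here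
at-lookup (a ∷ w) (suc i) = there (at-lookup w i)

at⇒lookup : ∀ {w : List A} {n b} → At w n b → ∃ λ i → toℕ i ≡ n × lookup w i ≡ b
at⇒lookup here       = zero , refl , refl
at⇒lookup (there at) with i , refl , refl ← at⇒lookup at = suc i , refl , refl

at-unique : ∀ {w : List A} {n a b} → At w n a → At w n b → a ≡ b
at-unique here       here        = refl
at-unique (there at) (there at′) = at-unique at at′

at-++⁺ˡ : ∀ {w : List A} {n b} → At w n b → ∀ u → At (w ++ u) n b
at-++⁺ˡ here       u = here
at-++⁺ˡ (there at) u = there (at-++⁺ˡ at u)

at-++⁻ʳ : ∀ (t : List A) {s n b} → At (t ++ s) (length t + n) b → At s n b
at-++⁻ʳ []      at         = at
at-++⁻ʳ (_ ∷ t) (there at) = at-++⁻ʳ t at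

at-++⁺ʳ : ∀ (t : List A) {s n b} → At s n b → At (t ++ s) (length t + n) b
at-++⁺ʳ []      at = at
at-++⁺ʳ (_ ∷ t) at = there (at-++⁺ʳ t at)

at-< : ∀ {w s : List A} → length s ≤ length w → ∀ {n b} → At s n b → ∃ λ a → At w n a
at-< {w = _ ∷ _} (s≤s s≤w) here       = _ , here
at-< {w = _ ∷ _} (s≤s s≤w) (there at) with a , at′ ← at-< s≤w at = a , there at′

at-tail : ∀ {a b n} {w : List A} → At (a ∷ w) (suc n) b → At w n b
at-tail (there at) = at

at⇒prefix : ∀ {w : List A} s → (∀ {n b} → At s n b → At w n b) → ∃ λ u → w ≡ s ++ u
at⇒prefix []      f = _ , refl
at⇒prefix (a ∷ s) f
  with here ← f here
  with u , refl ← at⇒prefix s (λ at → at-tail (f (there at))) = u , refl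

-- A period of a word is the difference of its length and the length of a border; unlike
-- periods stated by indices, borders are symmetric under reversal.
Border : List A → ℕ → Set
Border w p = ∃ λ t → ∃₂ λ s u → length t ≡ p × w ≡ t ++ s × w ≡ s ++ u

border⇒isPeriod : ∀ {w : List A} {p} → 1 ≤ p → Border w p → IsPeriod w p
border⇒isPeriod {w = w} {p} 1≤p (t , s , u , refl , w≡ts , w≡su) = record
  { positive = 1≤p
  ; bounded  = ≤-trans (m≤m+n (length t) (length s))
                 (≤-reflexive (sym (trans (cong length w≡ts) (length-++ t))))
  ; repeats  = λ i j j≡ → at-unique (at-lookup w i) (subst (λ x → At x _ _) (sym w≡su) (at-++⁺ˡ
      (at-++⁻ʳ t (subst₂ (λ x n → At x n (lookup w j)) w≡ts (trans j≡ (+-comm (toℕ i) p))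
        (at-lookup w j))) u))
  }

-- Letter `n` of `s = drop p w` is letter `p + n` of `w`, which the period equates with letter `n`.
-- Hence `s` is also a prefix of `w`.
isPeriod⇒border : ∀ {w : List A} {p} → IsPeriod w p → Border w p
isPeriod⇒border {w = w} {p} per with t , refl , w≡ ← split-at p w (IsPeriod.bounded per) =
  t , s , proj₁ prefix , refl , w≡ , proj₂ prefix
  where
  s = drop p w
  at-s⇒at-w : ∀ {n b} → At s n b → At w n b
  at-s⇒at-w at
    with a , at-w ← at-< {w = w} (≤-trans (≤-reflexive (length-drop p w)) (m∸n≤m (length w) p)) at
    with j , j≡ , refl ← at⇒lookup (subst (λ x → At x _ _) (sym w≡) (at-++⁺ʳ t at))
    with i , refl , refl ← at⇒lookup at-w =
    subst (At w (toℕ i)) (IsPeriod.repeats per i j (trans j≡ (+-comm (length t) (toℕ i)))) at-w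
  prefix = at⇒prefix s at-s⇒at-w

-- Reversal exchanges the two factorisations. Its new first block is `reverse u`, and `u` is as long
-- as `t` because each completes `s` to `w`.
border-reverse : ∀ {w : List A} {p} → Border w p → Border (reverse w) p
border-reverse {w = w} (t , s , u , refl , w≡ts , w≡su) =
  reverse u , reverse s , reverse t ,
  trans (length-reverse u) (+-cancelˡ-≡ (length s) _ _ (trans (sym (length-++ s))
    (trans (cong length (trans (sym w≡su) w≡ts))
      (trans (length-++ t) (+-comm (length t) (length s)))))) ,
  trans (cong reverse w≡su) (reverse-++ s u) ,
  trans (cong reverse w≡ts) (reverse-++ t s)

border⇒agree : ∀ {w : List A} {p} → Border w p → ∀ v → Agree (length w ∸ p) (w ++ v) (drop p (w ++ v))
border⇒agree {w = w} (t , s , u , refl , w≡ts , w≡su) v =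
  subst (λ k → Agree k (w ++ v) (drop (length t) (w ++ v)))
    (sym (trans (cong (λ x → length x ∸ length t) w≡ts)
           (trans (cong (_∸ length t) (length-++ t)) (m+n∸m≡n (length t) (length s)))))
    (subst₂ (Agree (length s))
      (trans (sym (++-assoc s u v)) (cong (_++ v) (sym w≡su)))
      (sym (trans (cong (drop (length t)) (trans (cong (_++ v) w≡ts) (++-assoc t s v)))
             (drop-length-++ t (s ++ v))))
      (agree-++ s))

prefix-≤ : ∀ (s x : List A) {u v} → length s ≤ length x → s ++ u ≡ x ++ v → ∃ λ y → x ≡ s ++ y
prefix-≤ []      x       _         _  = x , refl
prefix-≤ (a ∷ s) (b ∷ x) (s≤s s≤x) eq
  with refl , eq′ ← ∷-injective eq
  with y , refl ← prefix-≤ s x s≤x eq′ = y , refl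

agree-drop⇒< : ∀ {p k} {r : List A} → 1 ≤ k → Agree k r (drop p r) → p < length r
agree-drop⇒< {p = p} {r = r} 1≤k agr = m∸n≢0⇒n<m λ eq →
  contradiction (≤-trans 1≤k (≤-trans (agree⇒≤length agr)
    (≤-reflexive (trans (length-drop p r) eq)))) λ ()

repetition⇒border : ∀ {p k} {r : List A} → 1 ≤ k → Agree k r (drop p r) →
                    ∃₂ λ w v → r ≡ w ++ v × length w ≡ p + k × Border w p
repetition⇒border {p = p} {k} {r} 1≤k agr
  with s , u , v , refl , r≡su , d≡ ← agree⇒common agr
  with t , refl , r≡ ← split-at p r (<⇒≤ (agree-drop⇒< 1≤k agr)) =
  t ++ s , v , r≡tsv , length-++ t , t , s , proj₁ pre , refl , refl , proj₂ pre
  where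
  r≡tsv : r ≡ (t ++ s) ++ v
  r≡tsv = trans r≡ (trans (cong (t ++_) d≡) (sym (++-assoc t s v)))
  pre = prefix-≤ s (t ++ s) (≤-trans (m≤n+m (length s) (length t)) (≤-reflexive (sym (length-++ t))))
          (trans (sym r≡su) r≡tsv)

isPeriod? : ∀ (w : List ℕ) p → Dec (IsPeriod w p)
isPeriod? w p = map′
  (λ (1≤p , p≤w , rep) → record { positive = 1≤p ; bounded = p≤w ; repeats = rep })
  (λ per → IsPeriod.positive per , IsPeriod.bounded per , IsPeriod.repeats per)
  (1 ≤? p ×-dec p ≤? length w ×-dec
    all? λ i → all? λ j → (toℕ j ℕ.≟ toℕ i + p) →-dec (lookup w i ℕ.≟ lookup w j))

-- A repetition provides some period, while `HasExponent` asks for the least one. Passing to a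
-- smaller period can only raise the exponent, so the bound 7/3 survives.
leastPeriod : ∀ (w : List ℕ) q → IsPeriod w q → ∃ λ p → p ≤ q × IsLeastPeriod w p
leastPeriod w = <-rec (λ q → IsPeriod w q → ∃ λ p → p ≤ q × IsLeastPeriod w p) step′
  where
  step′ : ∀ q → (∀ {p} → p < q → IsPeriod w p → ∃ λ m → m ≤ p × IsLeastPeriod w m) →
          IsPeriod w q → ∃ λ p → p ≤ q × IsLeastPeriod w p
  step′ q rec per with anyUpTo? (isPeriod? w) q
  ... | no  none = q , ≤-refl ,
    record { isPeriod = per ; least = λ per′ → ≮⇒≥ λ p<q → none (_ , p<q , per′) }
  ... | yes (p , p<q , per′) with m , m≤p , least ← rec p<q per′ = m , ≤-trans m≤p (<⇒≤ p<q) , least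

7/3≤⁺ : ∀ {n p} .{{_ : NonZero p}} → 7 * p ≤ 3 * n → (+ 7 / 3) ℚᵘ.≤ (+ n / p)
7/3≤⁺ {n} {suc p} 7p≤3n = *≤* (subst₂ ℤ._≤_ (ℤₚ.pos-* 7 (suc p))
  (trans (cong +_ (*-comm 3 n)) (ℤₚ.pos-* n 3)) (ℤ.+≤+ 7p≤3n))

7/3≤⁻ : ∀ {n p} .{{_ : NonZero p}} → (+ 7 / 3) ℚᵘ.≤ (+ n / p) → 7 * p ≤ 3 * n
7/3≤⁻ {n} {suc p} (*≤* le) =
  ≤-trans (ℤₚ.drop‿+≤+ (subst (+ (7 * suc p) ℤ.≤_) (sym (ℤₚ.pos-* n 3)) le)) (≤-reflexive (*-comm n 3))

7p≤3[p+k] : ∀ {m p k} → m ≤ p → 4 * p ≤ 3 * k → 7 * m ≤ 3 * (p + k)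
7p≤3[p+k] {m} {p} {k} m≤p 4p≤3k = begin
  7 * m         ≤⟨ *-monoʳ-≤ 7 m≤p ⟩
  7 * p         ≡⟨ *-distribʳ-+ p 3 4 ⟩
  3 * p + 4 * p ≤⟨ +-monoʳ-≤ (3 * p) 4p≤3k ⟩
  3 * p + 3 * k ≡⟨ *-distribˡ-+ 3 p k ⟨
  3 * (p + k)   ∎
  where open ≤-Reasoning

4p≤3[n∸p] : ∀ {p n} → 7 * p ≤ 3 * n → 4 * p ≤ 3 * (n ∸ p)
4p≤3[n∸p] {p} {n} 7p≤3n = begin
  4 * p                   ≡⟨ m+n∸m≡n (3 * p) (4 * p) ⟨
  (3 * p + 4 * p) ∸ 3 * p ≡⟨ cong (_∸ 3 * p) (*-distribʳ-+ p 3 4) ⟨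
  7 * p ∸ 3 * p           ≤⟨ ∸-monoˡ-≤ (3 * p) 7p≤3n ⟩
  3 * n ∸ 3 * p           ≡⟨ *-distribˡ-∸ 3 n p ⟨
  3 * (n ∸ p)             ∎
  where open ≤-Reasoning

free⇒¬sevenThirds : ∀ {c} → (+ 7 / 3) -Free reverse c → ¬ SevenThirds c
free⇒¬sevenThirds free (p , zero , () , _)
free⇒¬sevenThirds free (p , suc k , 4p≤3k , agr)
  with w , v , refl , len , bord ← repetition⇒border {p = suc p} (s≤s z≤n) agr
  with m , m≤p , least ←
    leastPeriod (reverse w) (suc p) (border⇒isPeriod (s≤s z≤n) (border-reverse bord)) =
  free (λ eq → contradiction (trans (sym len′) (cong length eq)) λ ()) (factor-reverse [] w v)
    (hasExponent least)
    (7/3≤⁺ (subst (λ n → 7 * m ≤ 3 * n) (sym len′) (7p≤3[p+k] m≤p 4p≤3k)))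
  where
  len′ = trans (length-reverse w) len
  instance
    m≢0 = >-nonZero (IsPeriod.positive (IsLeastPeriod.isPeriod least))

-- From the definitions to `Valid` and back

overlapFree-tail : ∀ a (r : List A) → OverlapFree (reverse (a ∷ r)) → OverlapFree (reverse r)
overlapFree-tail a r free b y = free b y ∘ factor-snoc a r

free-tail : ∀ k (c : List ℕ) → (+ 7 / 3) -Free reverse (k ∷ c) → (+ 7 / 3) -Free reverse c
free-tail k c free w≢[] = free w≢[] ∘ factor-snoc k c

valid-curlings : ∀ r → OverlapFree (reverse r) → (+ 7 / 3) -Free reverse (curlings r) →
                 Valid r (curlings r)
valid-curlings []      _     _     = []
valid-curlings (a ∷ r) ofree cfree =
  step (valid-curlings r (overlapFree-tail a r ofree)
         (free-tail (curlingNumber _≟_ (reverse (a ∷ r))) (curlings r) cfree))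
       (overlapFree⇒¬overlap ofree) (curlings-curl a r ofree) (free⇒¬sevenThirds cfree)

-- An occurrence anywhere in the word lies at the end of some prefix. Removing the later letters `u`
-- exposes that prefix, which was tested when its last letter was added.
valid-¬overlap : ∀ u {r : List A} {c} → Valid (u ++ r) c → ¬ Overlap r
valid-¬overlap []      []               (_ , ())
valid-¬overlap []      (step _ ¬ov _ _) = ¬ov
valid-¬overlap (_ ∷ u) (step val _ _ _) = valid-¬overlap u val

valid-¬sevenThirds : ∀ u {r : List A} {c} → Valid r (u ++ c) → ¬ SevenThirds c
valid-¬sevenThirds []      []                = endsInSevenThirds-complete [] refl
valid-¬sevenThirds []      (step _ _ _ ¬pow) = ¬pow
valid-¬sevenThirds (_ ∷ u) (step val _ _ _)  = valid-¬sevenThirds u val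

valid⇒overlapFree : ∀ {r : List A} {c} → Valid r c → OverlapFree (reverse r)
valid⇒overlapFree {r = r} val a y f with u , v , refl ← factor-reverse⁻ {r = r} f =
  valid-¬overlap u val
    (subst (λ w → Overlap (w ++ v)) (sym (reverse-overlap a y)) (prefix⇒overlap a (reverse y) v))

valid⇒free : ∀ {r : List A} {c} → Valid r c → (+ 7 / 3) -Free reverse c
valid⇒free {c = c} val {w = w} w≢[] f (hasExponent {suc p} least) 7/3≤
  with u , v , refl ← factor-reverse⁻ {r = c} f =
  valid-¬sevenThirds u val (p , _ ,
    4p≤3[n∸p] {suc p} {length (reverse w)}
      (subst (λ n → 7 * suc p ≤ 3 * n) (sym (length-reverse w)) (7/3≤⁻ 7/3≤)) ,
    border⇒agree (border-reverse (isPeriod⇒border (IsLeastPeriod.isPeriod least))) v)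

-- Curling numbers that pass the check are the true ones. The `C` of a concrete word can thus be
-- certified without evaluating `curlingNumber`, which tries all candidates for `y` and `z`.
valid⇒≡curlings : ∀ {r c} → Valid r c → c ≡ curlings r
valid⇒≡curlings []                             = refl
valid⇒≡curlings val@(step {a} {r} val′ _ curl _) =
  cong₂ _∷_ (curl-unique curl (curlings-curl a r (valid⇒overlapFree val))) (valid⇒≡curlings val′)

-- The upper bound

refute-extensions : ∀ {n r c} → refute (extensions n c) r ≡ true →
                    ∀ w v → length w ≡ n → length v ≡ n → ¬ Valid (w ʳ++ r) (v ʳ++ c)
refute-extensions eq w v len refl val = refute-sound (valid⇒branch w v len val) w eq len val

abstract
  -- Checking `refl` runs the search. The depths 83 here and 82 below complete 01 and 001 to length
  -- 85; the lists of numbers are the curling numbers of their prefixes, latest first.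
  refute-01 : refute (extensions 83 (1 ∷ 1 ∷ [])) (1F ∷ 0F ∷ []) ≡ true
  refute-01 = refl

  refute-001 : refute (extensions 82 (1 ∷ 2 ∷ 1 ∷ [])) (1F ∷ 0F ∷ 0F ∷ []) ≡ true
  refute-001 = refl

curl-[_] : ∀ (a : A) {k} → Curl (a ∷ []) k → k ≡ 1
curl-[ a ] (one _)            = refl
curl-[ a ] (two (zero , ()))
curl-[ a ] (two (suc _ , ()))

-- Unequal last letters exclude a square of period 1, and any longer period needs at least four
-- letters where there are at most three.
curl-≢ : ∀ {a b : A} {r k} → a ≢ b → length r ≤ 1 → Curl (a ∷ b ∷ r) k → k ≡ 1
curl-≢ a≢b _ (one _) = refl
curl-≢ a≢b _ (two (zero , agr)) = contradiction (agree-head agr) a≢b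
curl-≢ {r = []} a≢b _ (two (suc zero , ()))
curl-≢ {r = []} a≢b _ (two (suc (suc _) , ()))
curl-≢ {r = _ ∷ []} a≢b _ (two (suc zero , (_ ∷ ())))
curl-≢ {r = _ ∷ []} a≢b _ (two (suc (suc zero) , ()))
curl-≢ {r = _ ∷ []} a≢b _ (two (suc (suc (suc _)) , ()))
curl-≢ {r = _ ∷ _ ∷ _} _ (s≤s ()) _

curl-≡ : ∀ {a : A} {k} → Curl (a ∷ a ∷ []) k → k ≡ 2
curl-≡ (one ¬sq) = contradiction (0 , (_ ∷ [])) ¬sq
curl-≡ (two _)   = refl

¬valid-01 : ∀ w v → length w ≡ 83 → length v ≡ 85 → ¬ Valid ((0F ∷ 1F ∷ w) ʳ++ []) (v ʳ++ [])
¬valid-01 w (k ∷ l ∷ v) len len′ val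
  with step (step _ _ curl₁ _) _ curl₂ _ ←
    valid-suffix w v {1F ∷ 0F ∷ []} {l ∷ k ∷ []} (trans len (sym (cong (_∸ 2) len′))) val
  with refl ← curl-[ _ ] curl₁ | refl ← curl-≢ (λ ()) z≤n curl₂ =
  refute-extensions {83} {1F ∷ 0F ∷ []} {1 ∷ 1 ∷ []} refute-01 w v len (cong (_∸ 2) len′) val

¬valid-001 : ∀ w v → length w ≡ 82 → length v ≡ 85 → ¬ Valid ((0F ∷ 0F ∷ 1F ∷ w) ʳ++ []) (v ʳ++ [])
¬valid-001 w (k ∷ l ∷ m ∷ v) len len′ val
  with step (step (step _ _ curl₁ _) _ curl₂ _) _ curl₃ _ ←
    valid-suffix w v {1F ∷ 0F ∷ 0F ∷ []} {m ∷ l ∷ k ∷ []} (trans len (sym (cong (_∸ 3) len′))) val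
  with refl ← curl-[ _ ] curl₁ | refl ← curl-≡ curl₂ | refl ← curl-≢ (λ ()) ≤-refl curl₃ =
  refute-extensions {82} {1F ∷ 0F ∷ 0F ∷ []} {1 ∷ 2 ∷ 1 ∷ []} refute-001 w v len (cong (_∸ 3) len′) val

rename : Fin 3 → Fin 3 → Fin 3 → Fin 3
rename a b c = if does (c ≟ a) then 0F else if does (c ≟ b) then 1F else 2F

rename-injective : ∀ a b → a ≢ b → Injective _≡_ _≡_ (rename a b)
rename-injective a b a≢b {c} {d} = from-yes (all? λ a → all? λ b → all? λ c → all? λ d →
  ¬? (a ≟ b) →-dec ((rename a b c ≟ rename a b d) →-dec (c ≟ d))) a b c d a≢b

rename-first : ∀ a b → rename a b a ≡ 0F
rename-first = from-yes (all? λ a → all? λ b → rename a b a ≟ 0F)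

rename-second : ∀ a b → a ≢ b → rename a b b ≡ 1F
rename-second = from-yes (all? λ a → all? λ b → ¬? (a ≟ b) →-dec (rename a b b ≟ 1F))

valid-rename : ∀ a b → a ≢ b → ∀ w {c} → Valid (w ʳ++ []) c → Valid (map (rename a b) w ʳ++ []) c
valid-rename a b a≢b w val =
  subst (λ r → Valid r _) (map-ʳ++ (rename a b) w) (valid-map (rename-injective a b a≢b) val)

¬valid-85 : ∀ w v → length w ≡ 85 → length v ≡ 85 → ¬ Valid (w ʳ++ []) (v ʳ++ [])
¬valid-85 (a ∷ b ∷ c ∷ w) v len len′ val with a ≟ b
... | no a≢b = ¬valid-01 (map (rename a b) (c ∷ w)) v
  (trans (length-map (rename a b) (c ∷ w)) (cong (_∸ 2) len)) len′
  (subst₂ (λ x y → Valid ((x ∷ y ∷ map (rename a b) (c ∷ w)) ʳ++ []) (v ʳ++ []))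
    (rename-first a b) (rename-second a b a≢b) (valid-rename a b a≢b (a ∷ b ∷ c ∷ w) val))
... | yes refl with a ≟ c
...   | no a≢c = ¬valid-001 (map (rename a c) w) v
  (trans (length-map (rename a c) w) (cong (_∸ 3) len)) len′
  (subst₂ (λ x y → Valid ((x ∷ x ∷ y ∷ map (rename a c) w) ʳ++ []) (v ʳ++ []))
    (rename-first a c) (rename-second a c a≢c) (valid-rename a c a≢c (a ∷ a ∷ c ∷ w) val))
...   | yes refl with k ∷ l ∷ m ∷ v′ ← v
  with step _ ¬ov _ _ ←
    valid-suffix w v′ {a ∷ a ∷ a ∷ []} {m ∷ l ∷ k ∷ []} (cong (_∸ 3) (trans len (sym len′))) val =
  ¬ov (0 , (a ∷ a ∷ []))

valid-drop : ∀ n {r : List A} {c} → Valid r c → Valid (drop n r) (drop n c)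
valid-drop zero    val              = val
valid-drop (suc n) []               = []
valid-drop (suc n) (step val _ _ _) = valid-drop n val

valid⇒length≤84 : ∀ {r : List (Fin 3)} {c} → Valid r c → length r ≤ 84
valid⇒length≤84 {r} {c} val = ≮⇒≥ λ 85≤r → ¬valid-85 (reverse r′) (reverse c′)
  (trans (length-reverse r′) (len 85≤r))
  (trans (length-reverse c′) (trans (sym (valid-length val′)) (len 85≤r)))
  (subst₂ Valid (sym (reverse-involutive r′)) (sym (reverse-involutive c′)) val′)
  where
  -- The letters appended last stand at the front of `r`, so dropping `n` of them leaves the
  -- reversed prefix of length 85.
  n = length r ∸ 85
  r′ = drop n r
  c′ = drop n c
  val′ = valid-drop n val
  len : 85 ≤ length r → length r′ ≡ 85
  len 85≤r = trans (length-drop n r) (m∸[m∸n]≡n 85≤r)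

-- A word of length 84

valid⇒free-C : ∀ {r c} → Valid r c → OverlapFree (reverse r) × (+ 7 / 3) -Free C _≟_ (reverse r)
valid⇒free-C {r} {c} val = valid⇒overlapFree val , subst ((+ 7 / 3) -Free_) eq (valid⇒free val)
  where
  eq : reverse c ≡ C _≟_ (reverse r)
  eq = sym (reverse-swap (trans (reverse-C (reverse r))
         (trans (cong curlings (reverse-involutive r)) (sym (valid⇒≡curlings val)))))

longest : List (Fin 3)
longest =
  0F ∷ 1F ∷ 1F ∷ 0F ∷ 1F ∷ 0F ∷ 0F ∷ 1F ∷ 0F ∷ 2F ∷ 0F ∷ 0F ∷ 2F ∷ 0F ∷
  2F ∷ 1F ∷ 2F ∷ 1F ∷ 1F ∷ 0F ∷ 0F ∷ 2F ∷ 0F ∷ 0F ∷ 2F ∷ 1F ∷ 0F ∷ 0F ∷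
  2F ∷ 1F ∷ 1F ∷ 0F ∷ 1F ∷ 0F ∷ 0F ∷ 1F ∷ 0F ∷ 2F ∷ 0F ∷ 0F ∷ 2F ∷ 0F ∷
  2F ∷ 1F ∷ 1F ∷ 0F ∷ 1F ∷ 1F ∷ 0F ∷ 2F ∷ 0F ∷ 0F ∷ 2F ∷ 0F ∷ 2F ∷ 1F ∷
  2F ∷ 1F ∷ 1F ∷ 0F ∷ 0F ∷ 2F ∷ 0F ∷ 0F ∷ 2F ∷ 1F ∷ 0F ∷ 0F ∷ 2F ∷ 1F ∷
  1F ∷ 2F ∷ 2F ∷ 0F ∷ 1F ∷ 1F ∷ 2F ∷ 2F ∷ 0F ∷ 2F ∷ 1F ∷ 1F ∷ 0F ∷ 0F ∷ []

longest-curlings : List ℕ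
longest-curlings =
  1 ∷ 1 ∷ 2 ∷ 1 ∷ 1 ∷ 2 ∷ 2 ∷ 1 ∷ 2 ∷ 1 ∷ 1 ∷ 2 ∷ 1 ∷ 2 ∷
  2 ∷ 1 ∷ 1 ∷ 2 ∷ 2 ∷ 1 ∷ 2 ∷ 1 ∷ 1 ∷ 2 ∷ 2 ∷ 1 ∷ 1 ∷ 2 ∷
  1 ∷ 2 ∷ 2 ∷ 1 ∷ 1 ∷ 2 ∷ 2 ∷ 1 ∷ 2 ∷ 1 ∷ 1 ∷ 2 ∷ 1 ∷ 2 ∷
  2 ∷ 1 ∷ 2 ∷ 1 ∷ 1 ∷ 2 ∷ 2 ∷ 1 ∷ 1 ∷ 2 ∷ 1 ∷ 2 ∷ 2 ∷ 1 ∷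
  1 ∷ 2 ∷ 2 ∷ 1 ∷ 2 ∷ 1 ∷ 1 ∷ 2 ∷ 2 ∷ 1 ∷ 1 ∷ 2 ∷ 1 ∷ 2 ∷
  2 ∷ 1 ∷ 2 ∷ 1 ∷ 1 ∷ 2 ∷ 1 ∷ 2 ∷ 2 ∷ 1 ∷ 1 ∷ 2 ∷ 1 ∷ 2 ∷ []

longest-valid : Valid (reverse longest) (reverse longest-curlings)
longest-valid = validᵇ-sound (reverse longest) (reverse longest-curlings) refl

theorem11 : (∃ λ (x : List (Fin 3)) → length x ≡ 84 × OverlapFree x × (+ 7 / 3) -Free C _≟_ x)
    × (∀ (x : List (Fin 3)) → OverlapFree x → (+ 7 / 3) -Free C _≟_ x → length x ≤ 84)
theorem11 = (longest , refl , valid⇒free-C longest-valid) , upper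
  where
  upper : ∀ (x : List (Fin 3)) → OverlapFree x → (+ 7 / 3) -Free C _≟_ x → length x ≤ 84
  upper x ofree cfree = subst (_≤ 84) (length-reverse x) (valid⇒length≤84 (valid-curlings (reverse x)
    (subst OverlapFree (sym (reverse-involutive x)) ofree)
    (subst ((+ 7 / 3) -Free_) (reverse-swap (reverse-C x)) cfree)))
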